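{- For all integers $n\ge 0$, the number $g(n)$ of receding stacks of size $n$ is equal to the number $F_0(n)$ of Frobenius symbols of size $n$ that contain a zero in the top row: $$g(n)=F_0(n).$$
   Context: A receding stack of size $n$ is a finite sequence of positive integers summing to $n$, of the form $a_1,\dots,a_r,c,b_s,b_{s-1},\dots,b_1$ with $r,s\ge 0$, such that $1\le a_1\le a_2\le\dots\le a_r\le c$ and $c> b_s\ge b_{s-1}\ge\dots\ge b_1\ge 1$, and such that every integer from $1$ to $c-1$ occurs at least once among $a_1,\dots,a_r$ and at least once among $b_1,\dots,b_s$. (Thus $c$ is the last occurrence of the largest part, and each underlying sequence is counted once.) For example, the receding stacks of size $4$ are $(1,2,1)$ and $(1,1,1,1)$, so $g(4)=2$. The generating function is $$\sum_{n\ge 0} g(n)q^n = 1+\sum_{m\ge 1}\frac{q^{m^2}}{(q)_{m-1}^2(1-q^m)},\qquad (q)_m:=\prod_{j=1}^{m}(1-q^j),$$ so that by convention $g(0)=1$. A Frobenius symbol is a pair of strictly decreasing sequences of nonnegative integers of the same length $k$, written as two rows $$\begin{pmatrix}\alpha_1 & \alpha_2 & \dots & \alpha_k\\ \beta_1 & \beta_2 & \dots & \beta_k\end{pmatrix},\qquad \alpha_1>\dots>\alpha_k\ge 0,\quad \beta_1>\dots>\beta_k\ge 0.$$ Its size is $k+\alpha_1+\dots+\alpha_k+\beta_1+\dots+\beta_k$. The top row is $(\alpha_1,\dots,\alpha_k)$.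
   Formalization: At n = 0 the literal claim fails: g(0) = 1 by convention, but the only Frobenius symbol of size 0 is empty and has no zero in its top row. The formal statement sets F_0(0) = 1 by convention; for n ≥ 1 it is the literal count. -}

module Defs where

open import Data.List.Base
  using (List; []; _∷_; _++_; _∷ʳ_; map; filter; length; cartesianProduct)
open import Data.List.Membership.Propositional using (_∈_)
open import Data.List.Membership.Propositional.Properties
open import Data.List.Properties using (∷-injective)
open import Data.List.Relation.Unary.All as All using (All; []; _∷_)
open import Data.List.Relation.Unary.AllPairs using ([]; _∷_)
open import Data.List.Relation.Unary.Any using (here; there)
open import Data.List.Relation.Unary.Linked as Linked using (Linked; []; [-]; _∷_; linked?)
open import Data.List.Relation.Unary.Linked.Properties using (Linked⇒All)
open import Data.List.Relation.Unary.Unique.Propositional using (Unique)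
import Data.List.Relation.Unary.Unique.Propositional.Properties as Unique
open import Data.Nat.Base
open import Data.Nat.ListAction using (sum)
open import Data.Nat.Properties
open import Data.List.Membership.DecPropositional _≟_ using (_∈?_)
open import Data.Product.Base using (_×_; _,_; proj₁; proj₂; ∃-syntax)
open import Data.Sum.Base using (inj₁; inj₂)
open import Function.Base using (_∘_)
open import Function.Bundles using (_⇔_; mk⇔)
open import Relation.Binary.PropositionalEquality using (_≡_; refl; cong)
open import Relation.Nullary using (Dec; yes; no; ¬_)
open import Relation.Nullary.Decidable using (_×-dec_; _→-dec_)

-- Here bs is read left to right, i.e. it is b_s , b_{s-1} , … , b_1.
record IsRecedingSplit (as : List ℕ) (c : ℕ) (bs : List ℕ) : Set where
  constructor recedingSplit
  field
    positive   : All (1 ≤_) (as ++ c ∷ bs)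
    ascending  : Linked _≤_ (as ∷ʳ c)
    belowPeak  : All (_< c) bs
    descending : Linked _≥_ bs
    receding   : ∀ {i} → i < c → 1 ≤ i → i ∈ as × i ∈ bs

IsRecedingStack : List ℕ → Set
IsRecedingStack xs =
  ∃[ as ] ∃[ c ] ∃[ bs ] (xs ≡ as ++ c ∷ bs × IsRecedingSplit as c bs)

-- (top row , bottom row)
Symbol : Set
Symbol = List ℕ × List ℕ

record IsFrobenius (s : Symbol) : Set where
  constructor frobenius
  field
    sameLength       : length (proj₁ s) ≡ length (proj₂ s)
    topDecreasing    : Linked _>_ (proj₁ s)
    bottomDecreasing : Linked _>_ (proj₂ s)

size : Symbol → ℕ
size (α , β) = length α + sum α + sum β

ZeroInTopRow : Symbol → Set
ZeroInTopRow (α , β) = 0 ∈ α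

isRecedingSplit? : ∀ as c bs → Dec (IsRecedingSplit as c bs)
isRecedingSplit? as c bs
  with All.all? (1 ≤?_) (as ++ c ∷ bs)
     | linked? _≤?_ (as ∷ʳ c)
     | All.all? (_<? c) bs
     | linked? _≥?_ bs
     | allUpTo? (λ i → (1 ≤? i) →-dec ((i ∈? as) ×-dec (i ∈? bs))) c
... | no ¬p | _     | _     | _     | _     = no (¬p ∘ IsRecedingSplit.positive)
... | yes _ | no ¬p | _     | _     | _     = no (¬p ∘ IsRecedingSplit.ascending)
... | yes _ | yes _ | no ¬p | _     | _     = no (¬p ∘ IsRecedingSplit.belowPeak)
... | yes _ | yes _ | yes _ | no ¬p | _     = no (¬p ∘ IsRecedingSplit.descending)
... | yes _ | yes _ | yes _ | yes _ | no ¬p =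
  no λ s → ¬p (IsRecedingSplit.receding s)
... | yes p | yes q | yes r | yes s | yes t = yes (recedingSplit p q r s t)

anySplit? : {P : List ℕ → ℕ → List ℕ → Set} → (∀ as c bs → Dec (P as c bs)) →
            ∀ xs → Dec (∃[ as ] ∃[ c ] ∃[ bs ] (xs ≡ as ++ c ∷ bs × P as c bs))
anySplit? P? [] = no λ where
  ([]    , _ , _ , () , _)
  (_ ∷ _ , _ , _ , () , _)
anySplit? P? (x ∷ xs) with P? [] x xs | anySplit? (λ as → P? (x ∷ as)) xs
... | yes p | _ = yes ([] , x , xs , refl , p)
... | no _  | yes (as , c , bs , refl , p) = yes (x ∷ as , c , bs , refl , p)
... | no ¬p | no ¬q = no λ where
  ([]     , _ , _  , refl , p) → ¬p p
  (_ ∷ as , c , bs , refl , p) → ¬q (as , c , bs , refl , p)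

isRecedingStack? : ∀ xs → Dec (IsRecedingStack xs)
isRecedingStack? = anySplit? isRecedingSplit?

isFrobenius? : ∀ s → Dec (IsFrobenius s)
isFrobenius? (α , β) with length α ≟ length β | linked? _>?_ α | linked? _>?_ β
... | no ¬p | _     | _     = no (¬p ∘ IsFrobenius.sameLength)
... | yes _ | no ¬p | _     = no (¬p ∘ IsFrobenius.topDecreasing)
... | yes _ | yes _ | no ¬p = no (¬p ∘ IsFrobenius.bottomDecreasing)
... | yes p | yes q | yes r = yes (frobenius p q r)

incHead : List ℕ → List ℕ
incHead []       = []
incHead (x ∷ xs) = suc x ∷ xs

-- All lists of positive integers with sum n.
compositions : ℕ → List (List ℕ)
compositions zero          = [] ∷ []
compositions (suc zero)    = (1 ∷ []) ∷ []
compositions (suc (suc n)) =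
  map (1 ∷_) (compositions (suc n)) ++ map incHead (compositions (suc n))

-- All strictly decreasing lists with entries below n; the entries of a
-- symbol are smaller than its size.
decreasing : ℕ → List (List ℕ)
decreasing zero    = [] ∷ []
decreasing (suc n) = map (n ∷_) (decreasing n) ++ decreasing n

recedingStacks : ℕ → List (List ℕ)
recedingStacks n = filter isRecedingStack? (compositions n)

frobeniusSymbols₀ : ℕ → List Symbol
frobeniusSymbols₀ n =
  filter (λ s → isFrobenius? s ×-dec ((size s ≟ n) ×-dec (0 ∈? proj₁ s)))
         (cartesianProduct (decreasing n) (decreasing n))

-- g 0 = 1 is the convention that goes with the constant term 1 of the
-- generating function; no sequence with a peak c ≥ 1 has size 0.
g : ℕ → ℕ
g zero      = 1
g n@(suc _) = length (recedingStacks n)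

-- Likewise the empty symbol, the only one of size 0, is counted at n = 0
-- although its top row has no entries; otherwise g 0 = F₀ 0 would fail.
F₀ : ℕ → ℕ
F₀ zero      = 1
F₀ n@(suc _) = length (frobeniusSymbols₀ n)

Enumerates : {A : Set} → List A → (A → Set) → Set
Enumerates xs P = Unique xs × (∀ x → x ∈ xs ⇔ P x)

IsComposition : ℕ → List ℕ → Set
IsComposition n xs = All (1 ≤_) xs × sum xs ≡ n

compositions-sound : ∀ n {xs} → xs ∈ compositions n → IsComposition n xs
compositions-sound zero          (here refl) = [] , refl
compositions-sound (suc zero)    (here refl) = s≤s z≤n ∷ [] , refl
compositions-sound (suc (suc n)) = step (compositions-sound (suc n))
  where
  step : (∀ {xs} → xs ∈ compositions (suc n) → IsComposition (suc n) xs) →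
         ∀ {xs} → xs ∈ compositions (suc (suc n)) → IsComposition (suc (suc n)) xs
  step ih xs∈ with ∈-++⁻ (map (1 ∷_) (compositions (suc n))) xs∈
  ... | inj₁ p with ys , ys∈ , refl ← ∈-map⁻ (1 ∷_) p
               with pos , eq ← ih ys∈ = s≤s z≤n ∷ pos , cong suc eq
  ... | inj₂ p with ∈-map⁻ incHead p
  ... | []     , ys∈ , refl with () ← proj₂ (ih ys∈)
  ... | y ∷ ys , ys∈ , refl with _ ∷ pos , eq ← ih ys∈ = s≤s z≤n ∷ pos , cong suc eq

compositions-complete : ∀ n {xs} → All (1 ≤_) xs → sum xs ≡ n → xs ∈ compositions n
compositions-complete zero {[]} _ _ = here refl
compositions-complete zero {suc _ ∷ _} _ ()
compositions-complete zero {zero ∷ _} (() ∷ _)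
compositions-complete (suc n) {[]} _ ()
compositions-complete (suc n) {zero ∷ _} (() ∷ _)
compositions-complete (suc zero) {suc zero ∷ []} _ _ = here refl
compositions-complete (suc zero) {suc zero ∷ zero ∷ _} (_ ∷ () ∷ _)
compositions-complete (suc zero) {suc zero ∷ suc _ ∷ _} _ ()
compositions-complete (suc zero) {suc (suc x) ∷ xs} _ ()
compositions-complete (suc (suc n)) {suc zero ∷ xs} (_ ∷ pos) eq =
  ∈-++⁺ˡ (∈-map⁺ (1 ∷_) (compositions-complete (suc n) pos (suc-injective eq)))
compositions-complete (suc (suc n)) {suc (suc x) ∷ xs} (_ ∷ pos) eq =
  ∈-++⁺ʳ (map (1 ∷_) (compositions (suc n)))
    (∈-map⁺ incHead (compositions-complete (suc n) (s≤s z≤n ∷ pos) (suc-injective eq)))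

incHead-injective : ∀ {xs ys} → incHead xs ≡ incHead ys → xs ≡ ys
incHead-injective {[]}    {[]}    refl = refl
incHead-injective {_ ∷ _} {_ ∷ _} refl = refl

compositions-unique : ∀ n → Unique (compositions n)
compositions-unique zero          = [] ∷ []
compositions-unique (suc zero)    = [] ∷ []
compositions-unique (suc (suc n)) = Unique.++⁺
  (Unique.map⁺ (proj₂ ∘ ∷-injective) (compositions-unique (suc n)))
  (Unique.map⁺ incHead-injective (compositions-unique (suc n)))
  λ (p , q) → disjoint (∈-map⁻ (1 ∷_) p) (∈-map⁻ incHead q)
  where
  disjoint : ∀ {xs} → ∃[ ys ] (ys ∈ compositions (suc n) × xs ≡ 1 ∷ ys) →
             ¬ (∃[ zs ] (zs ∈ compositions (suc n) × xs ≡ incHead zs))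
  disjoint (_ , _ , refl) (zero ∷ _ , zs∈ , refl)
    with () ∷ _ ← proj₁ (compositions-sound (suc n) zs∈)

recedingStacks-enumerates :
  ∀ n → Enumerates (recedingStacks n) (λ xs → IsRecedingStack xs × sum xs ≡ n)
recedingStacks-enumerates n =
  Unique.filter⁺ isRecedingStack? (compositions-unique n) , λ xs → mk⇔ to from
  where
  to : ∀ {xs} → xs ∈ recedingStacks n → IsRecedingStack xs × sum xs ≡ n
  to p with q , r ← ∈-filter⁻ isRecedingStack? p = r , proj₂ (compositions-sound n q)
  from : ∀ {xs} → IsRecedingStack xs × sum xs ≡ n → xs ∈ recedingStacks n
  from (r@(_ , _ , _ , refl , split) , eq) = ∈-filter⁺ isRecedingStack?
    (compositions-complete n (IsRecedingSplit.positive split) eq) r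

decreasing-bound : ∀ n {xs} → xs ∈ decreasing n → All (_< n) xs
decreasing-bound zero    (here refl) = []
decreasing-bound (suc n) xs∈ with ∈-++⁻ (map (n ∷_) (decreasing n)) xs∈
... | inj₁ p with _ , ys∈ , refl ← ∈-map⁻ (n ∷_) p
             = ≤-refl ∷ All.map m≤n⇒m≤1+n (decreasing-bound n ys∈)
... | inj₂ p = All.map m≤n⇒m≤1+n (decreasing-bound n p)

decreasing-complete : ∀ n {xs} → Linked _>_ xs → All (_< n) xs → xs ∈ decreasing n
decreasing-complete zero    {[]}     _ _ = here refl
decreasing-complete zero    {_ ∷ _}  _ (() ∷ _)
decreasing-complete (suc n) {[]}     _ _ =
  ∈-++⁺ʳ (map (n ∷_) (decreasing n)) (decreasing-complete n [] [])
decreasing-complete (suc n) {x ∷ xs} l (x<1+n ∷ _) with x ≟ n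
... | yes refl = ∈-++⁺ˡ (∈-map⁺ (n ∷_) (decreasing-complete n (Linked.tail l) (tail< l)))
  where
  tail< : ∀ {y ys} → Linked _>_ (y ∷ ys) → All (_< y) ys
  tail< [-]      = []
  tail< (r ∷ rs) = Linked⇒All (λ p q → <-trans q p) r rs
... | no x≢n = ∈-++⁺ʳ (map (n ∷_) (decreasing n))
  (decreasing-complete n l (below l (≤∧≢⇒< (s≤s⁻¹ x<1+n) x≢n)))
  where
  below : ∀ {y ys} → Linked _>_ (y ∷ ys) → y < n → All (_< n) (y ∷ ys)
  below [-]      y<n = y<n ∷ []
  below (r ∷ rs) y<n = y<n ∷ below rs (<-trans r y<n)

decreasing-unique : ∀ n → Unique (decreasing n)
decreasing-unique zero    = [] ∷ []
decreasing-unique (suc n) = Unique.++⁺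
  (Unique.map⁺ (proj₂ ∘ ∷-injective) (decreasing-unique n)) (decreasing-unique n)
  λ (p , q) → disjoint (∈-map⁻ (n ∷_) p) (decreasing-bound n q)
  where
  disjoint : ∀ {xs} → ∃[ ys ] (ys ∈ decreasing n × xs ≡ n ∷ ys) → ¬ All (_< n) xs
  disjoint (_ , _ , refl) (n<n ∷ _) = <-irrefl refl n<n

all≤sum : ∀ xs → All (_≤ sum xs) xs
all≤sum []       = []
all≤sum (x ∷ xs) = m≤m+n x _ ∷ All.map (λ p → ≤-trans p (m≤n+m _ x)) (all≤sum xs)

entries<size : ∀ α β → length α ≡ length β →
               All (_< size (α , β)) α × All (_< size (α , β)) β
entries<size []      []      _ = [] , []
entries<size (x ∷ α) (y ∷ β) _ =
    All.map (λ p → s≤s (≤-trans (≤-trans p (m≤n+m _ (length α))) (m≤m+n _ _)))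
            (all≤sum (x ∷ α))
  , All.map (λ p → s≤s (≤-trans p (m≤n+m _ (length α + sum (x ∷ α)))))
            (all≤sum (y ∷ β))

frobeniusSymbols₀-enumerates :
  ∀ n → Enumerates (frobeniusSymbols₀ n)
          (λ s → IsFrobenius s × size s ≡ n × ZeroInTopRow s)
frobeniusSymbols₀-enumerates n =
    Unique.filter⁺ _ (Unique.cartesianProduct⁺ (decreasing-unique n) (decreasing-unique n))
  , λ s → mk⇔ (proj₂ ∘ ∈-filter⁻ _ {xs = cartesianProduct (decreasing n) (decreasing n)}) from
  where
  from : ∀ {s} → IsFrobenius s × size s ≡ n × ZeroInTopRow s → s ∈ frobeniusSymbols₀ n
  from {α , β} r@(frobenius len α> β> , refl , _)
    with α< , β< ← entries<size α β len
    = ∈-filter⁺ _ (∈-cartesianProduct⁺ (decreasing-complete n α> α<)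
                                       (decreasing-complete n β> β<)) r

{-# OPTIONS --safe #-}

-- Both sides of q^{m²} / ((q)_{m-1}² (1 - q^m)) count the same data: with
-- m = k + 1, a number r and two families es, ds of k numbers.  In a receding
-- stack with peak k + 1, part j occurs es_j + 1 times on the left and ds_j + 1
-- times on the right for j ≤ k, and the peak occurs r further times.  In a
-- Frobenius symbol with k + 1 columns and a zero in the top row, ds_j + 1 and
-- es_j + 1 are the successive differences of the top and bottom rows, and r is
-- the last entry of the bottom row.  Passing from one to the other is
-- conjugation of partitions, applied on each side, so it preserves the size.
module Submission where

open import Defs
open import Data.List.Base
  using (List; []; _∷_; _++_; _∷ʳ_; length; map; replicate; reverse)
open import Data.List.Membership.Propositional using (_∈_; _∉_)
open import Data.List.Membership.Propositional.Properties
  using (∈-++⁺ʳ; ∈-map⁺; ∈-map⁻)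
open import Data.List.Membership.Propositional.Properties.WithK using (unique⇒irrelevant)
open import Data.List.Properties
  using (∷-injective; length-map; length-replicate; reverse-injective;
         reverse-involutive; unfold-reverse)
open import Data.List.Relation.Binary.BagAndSetEquality using (∼bag⇒↭)
open import Data.List.Relation.Binary.Permutation.Propositional.Properties
  using (↭-length; ↭-reverse)
open import Data.List.Relation.Unary.All as All using (All; []; _∷_)
import Data.List.Relation.Unary.All.Properties as All
open import Data.List.Relation.Unary.AllPairs using (AllPairs; []; _∷_)
import Data.List.Relation.Unary.AllPairs.Properties as AllPairs
open import Data.List.Relation.Unary.Any using (here; there)
import Data.List.Relation.Unary.Any.Properties as Any
open import Data.List.Relation.Unary.Linked using (Linked; []; [-]; _∷_)
open import Data.List.Relation.Unary.Linked.Properties using (AllPairs⇒Linked; Linked⇒AllPairs)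
open import Data.List.Relation.Unary.Unique.Propositional using (Unique)
import Data.List.Relation.Unary.Unique.Propositional.Properties as Unique
open import Data.Nat.Base
open import Data.Nat.ListAction using (sum)
open import Data.Nat.ListAction.Properties using (sum-++; sum-↭)
open import Data.Nat.Properties
open import Data.Nat.Tactic.RingSolver using (solve-∀)
open import Data.Product.Base using (Σ; ∃-syntax; _×_; _,_; proj₁; proj₂)
open import Data.Vec.Base as Vec using (Vec; []; _∷_)
open import Function.Base using (_∘_; flip)
open import Function.Bundles using (Equivalence; mk↔ₛ′)
open import Level using (0ℓ)
open import Relation.Binary.Core using (Rel)
open import Relation.Binary.PropositionalEquality
open import Relation.Nullary using (yes; no; contradiction)

private
  variable
    A B C : Set
    x : A
    xs ys : List A
    i j k r r′ : ℕ

-- Counting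

-- Membership in a list without repetitions has at most one proof, so any two maps between the
-- membership types are mutually inverse and the lists agree as bags.
unique∧set⇒length≡ : Unique xs → Unique ys →
                     (∀ {x : A} → x ∈ xs → x ∈ ys) → (∀ {x} → x ∈ ys → x ∈ xs) →
                     length xs ≡ length ys
unique∧set⇒length≡ xs! ys! to from = ↭-length (∼bag⇒↭ (mk↔ₛ′ to from
  (λ _ → unique⇒irrelevant ys! _ _) (λ _ → unique⇒irrelevant xs! _ _)))

map-preimage : (f : C → A) → (∀ {x} → x ∈ xs → ∃[ z ] x ≡ f z) → ∃[ zs ] xs ≡ map f zs
map-preimage {xs = []}    f pre = [] , refl
map-preimage {xs = _ ∷ _} f pre with pre (here refl) | map-preimage f (pre ∘ there)
... | z , refl | zs , refl = z ∷ zs , refl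

-- Together the fields make `f` a bijection from the parameters satisfying `V` onto the elements
-- satisfying `P`. Here `complete` yields only a preimage; `reflecting` then shows that it satisfies
-- `V`.
record Parametrises (f : C → A) (P : A → Set) (V : C → Set) : Set where
  field
    injective  : ∀ {z w} → f z ≡ f w → z ≡ w
    sound      : ∀ {z} → V z → P (f z)
    complete   : P x → ∃[ z ] x ≡ f z
    reflecting : ∀ {z} → P (f z) → V z

-- The first enumeration is pulled back along `f` to a list `zs` of parameters; its image under `h`
-- has no repetitions and the same members as the second enumeration.
parametrised⇒equinumerous :
  {P : A → Set} {Q : B → Set} {V : C → Set} {f : C → A} {h : C → B} →
  Parametrises f P V → Parametrises h Q V →
  Enumerates xs P → Enumerates ys Q → length xs ≡ length ys
parametrised⇒equinumerous {xs = xs} {ys = ys} {f = f} {h = h} F H (xs! , xs≈P) (ys! , ys≈Q)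
  with zs , refl ← map-preimage f (Parametrises.complete F ∘ Equivalence.to (xs≈P _)) = begin
    length (map f zs)  ≡⟨ length-map f zs ⟩
    length zs          ≡⟨ length-map h zs ⟨
    length (map h zs)  ≡⟨ unique∧set⇒length≡ (Unique.map⁺ H.injective (Unique.map⁻ xs!)) ys! to from ⟩
    length ys          ∎
  where
  open ≡-Reasoning
  module F = Parametrises F
  module H = Parametrises H
  to : ∀ {y} → y ∈ map h zs → y ∈ ys
  to y∈ with z , z∈ , refl ← ∈-map⁻ h y∈ =
    Equivalence.from (ys≈Q _) (H.sound (F.reflecting (Equivalence.to (xs≈P _) (∈-map⁺ f z∈))))
  from : ∀ {y} → y ∈ ys → y ∈ map h zs
  from y∈ with Qy ← Equivalence.to (ys≈Q _) y∈ with z , refl ← H.complete Qy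
    -- The parameter `z` of `y` satisfies `V`, so `f z` occurs in `map f zs`; injectivity of `f`
    -- then places `z` itself in `zs`.
    with w , w∈ , fz≡fw ← ∈-map⁻ f (Equivalence.from (xs≈P _) (F.sound (H.reflecting Qy)))
    with refl ← F.injective fz≡fw = ∈-map⁺ h w∈

-- Lists

module _ {R : Rel A 0ℓ} where

  AllPairs-reverse⁺ : AllPairs R xs → AllPairs (flip R) (reverse xs)
  AllPairs-reverse⁺ [] = []
  AllPairs-reverse⁺ {xs = x ∷ xs} (Rx ∷ Rxs) rewrite unfold-reverse x xs =
    AllPairs.++⁺ (AllPairs-reverse⁺ Rxs) ([] ∷ [])
      (All.tabulate λ y∈ → All.lookup Rx (Any.reverse⁻ y∈) ∷ [])

  AllPairs-∷ʳ⁻ : AllPairs R (xs ∷ʳ x) → AllPairs R xs × All (λ y → R y x) xs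
  AllPairs-∷ʳ⁻ {xs = []}    _ = [] , []
  AllPairs-∷ʳ⁻ {xs = _ ∷ _} (Ry ∷ Rys)
    with Rxs , Rx ← AllPairs-∷ʳ⁻ Rys | py , Ryx ← All.∷ʳ⁻ Ry = py ∷ Rxs , Ryx ∷ Rx

All-reverse⁺ : {P : A → Set} → All P xs → All P (reverse xs)
All-reverse⁺ pxs = All.tabulate (All.lookup pxs ∘ Any.reverse⁻)

∈-replicate-++⁻ : ∀ n {y : A} → y ∈ replicate n x ++ xs → y ≢ x → y ∈ xs
∈-replicate-++⁻ zero    y∈          y≢x = y∈
∈-replicate-++⁻ (suc n) (here y≡x) y≢x = contradiction y≡x y≢x
∈-replicate-++⁻ (suc n) (there y∈) y≢x = ∈-replicate-++⁻ n y∈ y≢x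

replicate-++-injective : ∀ m n → x ∉ xs → x ∉ ys →
                         replicate m x ++ xs ≡ replicate n x ++ ys → m ≡ n × xs ≡ ys
replicate-++-injective zero    zero    x∉xs x∉ys eq   = refl , eq
replicate-++-injective zero    (suc n) x∉xs x∉ys refl = contradiction (here refl) x∉xs
replicate-++-injective (suc m) zero    x∉xs x∉ys refl = contradiction (here refl) x∉ys
replicate-++-injective (suc m) (suc n) x∉xs x∉ys eq
  with refl , eq′ ← replicate-++-injective m n x∉xs x∉ys (proj₂ (∷-injective eq)) = refl , eq′

sum-replicate : ∀ n x → sum (replicate n x) ≡ n * x
sum-replicate zero    x = refl
sum-replicate (suc n) x = cong (x +_) (sum-replicate n x)

replicate-sorted : ∀ n → AllPairs _≤_ (replicate n i)
replicate-sorted zero    = []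
replicate-sorted (suc n) = All.replicate⁺ n ≤-refl ∷ replicate-sorted n

constant⇒replicate : All (i ≤_) xs → All (_≤ i) xs → xs ≡ replicate (length xs) i
constant⇒replicate []          []          = refl
constant⇒replicate (i≤x ∷ i≤) (x≤i ∷ ≤i) = cong₂ _∷_ (≤-antisym x≤i i≤x) (constant⇒replicate i≤ ≤i)

-- The peak is the last occurrence of the maximum, hence determined by the list.
peak-split-injective : ∀ xs xs′ {c c′ ys ys′} →
  All (_≤ c) xs → All (_< c) ys → All (_≤ c′) xs′ → All (_< c′) ys′ →
  xs ++ c ∷ ys ≡ xs′ ++ c′ ∷ ys′ → xs ≡ xs′ × c ≡ c′ × ys ≡ ys′
peak-split-injective []       []         _          _    _          _     refl = refl , refl , refl
peak-split-injective []       (_ ∷ xs′) _          ys<c (c≤c′ ∷ _) _     refl =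
  contradiction c≤c′ (<⇒≱ (All.lookup ys<c (∈-++⁺ʳ xs′ (here refl))))
peak-split-injective (_ ∷ xs) []         (c′≤c ∷ _) _    _          ys<c′ refl =
  contradiction c′≤c (<⇒≱ (All.lookup ys<c′ (∈-++⁺ʳ xs (here refl))))
peak-split-injective (_ ∷ xs) (_ ∷ xs′) (_ ∷ xs≤) ys< (_ ∷ xs′≤) ys′< eq
  with refl , eq′ ← ∷-injective eq
  with refl , refl , refl ← peak-split-injective xs xs′ xs≤ ys< xs′≤ ys′< eq′ = refl , refl , refl

strip-minimum : AllPairs _≤_ xs → All (i ≤_) xs →
                ∃[ m ] ∃[ ys ] (xs ≡ replicate m i ++ ys × AllPairs _≤_ ys × All (i <_) ys)
strip-minimum [] [] = 0 , [] , refl , [] , []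
strip-minimum {xs = x ∷ xs} {i = i} (x≤xs ∷ xs↗) (i≤x ∷ i≤xs) with i ≟ x
... | no i≢x = 0 , _ , refl , x≤xs ∷ xs↗ , i<x ∷ All.map (<-≤-trans i<x) x≤xs
  where i<x = ≤∧≢⇒< i≤x i≢x
... | yes refl with m , ys , refl , ys↗ , i<ys ← strip-minimum xs↗ i≤xs =
  suc m , ys , refl , ys↗ , i<ys

-- One side of a stack

-- An entry `e` stands for the multiplicity `suc e`, which builds in that no value from `i` up to
-- but excluding `i + k` is skipped. Only the top value `i + k` may be absent, when `r` is 0.
blocks : ℕ → ℕ → Vec ℕ k → List ℕ
blocks i r []       = replicate r i
blocks i r (e ∷ es) = replicate (suc e) i ++ blocks (suc i) r es

blocks-≥ : ∀ i r (es : Vec ℕ k) → All (i ≤_) (blocks i r es)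
blocks-≥ i r []       = All.replicate⁺ r ≤-refl
blocks-≥ i r (e ∷ es) =
  All.++⁺ (All.replicate⁺ (suc e) ≤-refl) (All.map <⇒≤ (blocks-≥ (suc i) r es))

blocks-≤ : ∀ i r (es : Vec ℕ k) → All (_≤ i + k) (blocks i r es)
blocks-≤ i r [] = All.replicate⁺ r (m≤m+n i 0)
blocks-≤ {suc k} i r (e ∷ es) rewrite +-suc i k =
  All.++⁺ (All.replicate⁺ (suc e) (m≤n⇒m≤1+n (m≤m+n i k))) (blocks-≤ (suc i) r es)

blocks-< : ∀ i (es : Vec ℕ k) → All (_< i + k) (blocks i 0 es)
blocks-< i [] = []
blocks-< {suc k} i (e ∷ es) rewrite +-suc i k =
  All.++⁺ (All.replicate⁺ (suc e) (s≤s (m≤m+n i k))) (blocks-< (suc i) es)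

blocks-sorted : ∀ i r (es : Vec ℕ k) → AllPairs _≤_ (blocks i r es)
blocks-sorted i r []       = replicate-sorted r
blocks-sorted i r (e ∷ es) =
  AllPairs.++⁺ (replicate-sorted (suc e)) (blocks-sorted (suc i) r es)
    (All.replicate⁺ (suc e) (All.map <⇒≤ (blocks-≥ (suc i) r es)))

∈-blocks : ∀ i r (es : Vec ℕ k) → i ≤ j → j < i + k → j ∈ blocks i r es
∈-blocks i r [] i≤j j<i rewrite +-identityʳ i = contradiction i≤j (<⇒≱ j<i)
∈-blocks {suc k} {j} i r (e ∷ es) i≤j j<c with i ≟ j
... | yes refl = here refl
... | no i≢j = ∈-++⁺ʳ (replicate (suc e) i)
  (∈-blocks (suc i) r es (≤∧≢⇒< i≤j i≢j) (subst (j <_) (+-suc i k) j<c))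

top∈blocks : ∀ i r (es : Vec ℕ k) → i + k ∈ blocks i (suc r) es
top∈blocks i r [] = here (+-identityʳ i)
top∈blocks {suc k} i r (e ∷ es) rewrite +-suc i k =
  ∈-++⁺ʳ (replicate (suc e) i) (top∈blocks (suc i) r es)

∉-blocks-suc : ∀ i r (es : Vec ℕ k) → i ∉ blocks (suc i) r es
∉-blocks-suc i r es i∈ = <-irrefl refl (All.lookup (blocks-≥ (suc i) r es) i∈)

-- The values after the initial run all exceed `i`, so the length of the run, and with it the first
-- entry of the vector, can be read off the list.
blocks-injective : ∀ i (es es′ : Vec ℕ k) → blocks i r es ≡ blocks i r′ es′ → r ≡ r′ × es ≡ es′
blocks-injective {r = r} {r′} i [] [] eq =
  trans (sym (length-replicate r)) (trans (cong length eq) (length-replicate r′)) , refl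
blocks-injective i (e ∷ es) (e′ ∷ es′) eq
  with refl , eq′ ← replicate-++-injective (suc e) (suc e′)
                      (∉-blocks-suc i _ es) (∉-blocks-suc i _ es′) eq
  with refl , refl ← blocks-injective (suc i) es es′ eq′ = refl , refl

-- Induction on `k`, peeling off the run of the least value; for `k = 0` the bounds squeeze every
-- entry to `i`.
blocks-complete : ∀ k → AllPairs _≤_ xs → All (i ≤_) xs → All (_≤ i + k) xs →
                  (∀ {j} → i ≤ j → j < i + k → j ∈ xs) →
                  ∃[ r ] Σ (Vec ℕ k) λ es → xs ≡ blocks i r es
blocks-complete {xs} {i} zero _ i≤xs xs≤c _ rewrite +-identityʳ i =
  length xs , [] , constant⇒replicate i≤xs xs≤c
blocks-complete {i = i} (suc k) xs↗ i≤xs xs≤c full rewrite +-suc i k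
  with strip-minimum xs↗ i≤xs
-- An empty run is impossible, since `i` itself must occur; hence the multiplicity has the form
-- `suc e`.
... | zero  , ys , refl , _ , i<ys =
  contradiction (All.lookup i<ys (full ≤-refl (s≤s (m≤m+n i k)))) (<-irrefl refl)
... | suc e , ys , refl , ys↗ , i<ys
  with r , es , refl ← blocks-complete k ys↗ i<ys (All.++⁻ʳ (replicate (suc e) i) xs≤c)
    (λ i<j j<c → ∈-replicate-++⁻ (suc e) (full (<⇒≤ i<j) j<c) (≢-sym (<⇒≢ i<j))) =
  r , e ∷ es , refl

-- One row of a symbol

leading : ℕ → Vec ℕ k → ℕ
leading r []       = r
leading r (e ∷ es) = suc e + leading r es

-- The vector records the gaps between neighbouring entries, each less one, so strict decrease holds
-- by construction; `r` is the last entry.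
row : ℕ → Vec ℕ k → List ℕ
row r []       = r ∷ []
row r (e ∷ es) = leading r (e ∷ es) ∷ row r es

leading-row : ∀ r (es : Vec ℕ k) → ∃[ xs ] row r es ≡ leading r es ∷ xs
leading-row r []       = [] , refl
leading-row r (e ∷ es) = row r es , refl

row-leading : ∀ r (es : Vec ℕ k) → row r es ≡ x ∷ xs → leading r es ≡ x
row-leading r es eq with ys , eq′ ← leading-row r es = proj₁ (∷-injective (trans (sym eq′) eq))

length-row : ∀ r (es : Vec ℕ k) → length (row r es) ≡ suc k
length-row r []       = refl
length-row r (e ∷ es) = cong suc (length-row r es)

row-decreasing : ∀ r (es : Vec ℕ k) → Linked _>_ (row r es)
row-decreasing r [] = [-]
row-decreasing r (e ∷ es) with leading-row r es | row-decreasing r es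
... | xs , eq | l rewrite eq = s≤s (m≤n+m (leading r es) e) ∷ l

row-injective : (es es′ : Vec ℕ k) → row r es ≡ row r′ es′ → r ≡ r′ × es ≡ es′
row-injective []       []         refl = refl , refl
row-injective {r = r} (e ∷ es) (e′ ∷ es′) eq
  with lead≡ , eq′ ← ∷-injective eq
  with refl , refl ← row-injective es es′ eq′ =
  refl , cong (_∷ es) (suc-injective (+-cancelʳ-≡ (leading r es) (suc e) (suc e′) lead≡))

row-complete : ∀ k → Linked _>_ xs → length xs ≡ suc k →
               ∃[ r ] Σ (Vec ℕ k) λ es → xs ≡ row r es
row-complete {x ∷ []} zero [-] _ = x , [] , refl
row-complete (suc k) (y<x ∷ l) len
  with r , es , eq ← row-complete k l (suc-injective len)
  -- As `y<x` means `suc y ≤ x`, the difference `e` is the gap less one.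
  with e , refl ← m≤n⇒∃[o]m+o≡n y<x =
  r , e ∷ es , cong₂ _∷_
    (trans (cong suc (+-comm _ e)) (cong (suc e +_) (sym (row-leading r es (sym eq))))) eq

0∈row : (es : Vec ℕ k) → 0 ∈ row 0 es
0∈row []       = here refl
0∈row (e ∷ es) = there (0∈row es)

-- Every entry before the last is a successor, so a zero can only be the last entry, which is `r`.
0∈row⇒≡0 : ∀ r (es : Vec ℕ k) → 0 ∈ row r es → r ≡ 0
0∈row⇒≡0 r []       (here 0≡r) = sym 0≡r
0∈row⇒≡0 r (e ∷ es) (there 0∈) = 0∈row⇒≡0 r es 0∈

-- Conjugation: the j-th entry of the row counts the parts of the blocks from 1 that are at least j.
sum-blocks-suc : ∀ i r (es : Vec ℕ k) →
                 sum (blocks (suc i) r es) ≡ i * leading r es + sum (row r es)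
sum-blocks-suc i r [] = trans (sum-replicate r (suc i)) (lemma i r)
  where
  lemma : ∀ i r → r * suc i ≡ i * r + (r + 0)
  lemma = solve-∀
sum-blocks-suc i r (e ∷ es) = begin
  sum (replicate (suc e) (suc i) ++ blocks (2+ i) r es)
    ≡⟨ sum-++ (replicate (suc e) (suc i)) _ ⟩
  sum (replicate (suc e) (suc i)) + sum (blocks (2+ i) r es)
    ≡⟨ cong₂ _+_ (sum-replicate (suc e) (suc i)) (sum-blocks-suc (suc i) r es) ⟩
  suc e * suc i + (suc i * leading r es + sum (row r es))
    ≡⟨ lemma i e (leading r es) (sum (row r es)) ⟩
  i * (suc e + leading r es) + (suc e + leading r es + sum (row r es)) ∎
  where
  open ≡-Reasoning
  lemma : ∀ i e l s → suc e * suc i + (suc i * l + s) ≡ i * (suc e + l) + (suc e + l + s)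
  lemma = solve-∀

-- The common parametrisation

Data : Set
Data = Σ ℕ λ k → ℕ × Vec ℕ k × Vec ℕ k

toStack : Data → List ℕ
toStack (k , r , es , ds) = blocks 1 r es ++ suc k ∷ reverse (blocks 1 0 ds)

-- The sides are crossed: the right side, where the peak value occurs 0 times after the peak,
-- becomes the top row, and this 0 is its final entry.
toSymbol : Data → Symbol
toSymbol (k , r , es , ds) = row 0 ds , row r es

sum-toStack : ∀ z → sum (toStack z) ≡ size (toSymbol z)
sum-toStack (k , r , es , ds) = begin
  sum (blocks 1 r es ++ suc k ∷ reverse (blocks 1 0 ds))
    ≡⟨ sum-++ (blocks 1 r es) _ ⟩
  sum (blocks 1 r es) + (suc k + sum (reverse (blocks 1 0 ds)))
    ≡⟨ cong (λ s → sum (blocks 1 r es) + (suc k + s)) (sum-↭ (↭-reverse (blocks 1 0 ds))) ⟩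
  sum (blocks 1 r es) + (suc k + sum (blocks 1 0 ds))
    -- For `i = 0` the multiple of `leading` vanishes, so each side has the same sum as its row. The
    -- peak `suc k` will account for the number of columns.
    ≡⟨ cong₂ (λ s t → s + (suc k + t)) (sum-blocks-suc 0 r es) (sum-blocks-suc 0 0 ds) ⟩
  sum (row r es) + (suc k + sum (row 0 ds))
    ≡⟨ +-comm (sum (row r es)) _ ⟩
  suc k + sum (row 0 ds) + sum (row r es)
    ≡⟨ cong (λ l → l + sum (row 0 ds) + sum (row r es)) (length-row 0 ds) ⟨
  length (row 0 ds) + sum (row 0 ds) + sum (row r es) ∎
  where open ≡-Reasoning

toStack-injective : ∀ {z w} → toStack z ≡ toStack w → z ≡ w
toStack-injective {k , r , es , ds} {k′ , r′ , es′ , ds′} eq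
  -- Equality of the peaks identifies `k` with `k′`, so that the vectors have the same length when
  -- the blocks are compared.
  with left≡ , refl , right≡ ← peak-split-injective _ _
         (blocks-≤ 1 r es) (All-reverse⁺ (blocks-< 1 ds))
         (blocks-≤ 1 r′ es′) (All-reverse⁺ (blocks-< 1 ds′)) eq
  with refl , refl ← blocks-injective 1 es es′ left≡
     | refl , refl ← blocks-injective 1 ds ds′ (reverse-injective right≡) = refl

toStack-receding : ∀ z → IsRecedingStack (toStack z)
toStack-receding (k , r , es , ds) = _ , _ , _ , refl , recedingSplit
  (All.++⁺ (blocks-≥ 1 r es) (s≤s z≤n ∷ All-reverse⁺ (blocks-≥ 1 0 ds)))
  (AllPairs⇒Linked (AllPairs.++⁺ (blocks-sorted 1 r es) ([] ∷ [])
    (All.map (_∷ []) (blocks-≤ 1 r es))))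
  (All-reverse⁺ (blocks-< 1 ds))
  (AllPairs⇒Linked (AllPairs-reverse⁺ (blocks-sorted 1 0 ds)))
  λ i<c 1≤i → ∈-blocks 1 r es 1≤i i<c , Any.reverse⁺ (∈-blocks 1 0 ds 1≤i i<c)

toStack-complete : IsRecedingStack xs → ∃[ z ] xs ≡ toStack z
toStack-complete (as , c , bs , refl , recedingSplit pos as↗ bs<c bs↘ full)
  -- Positivity of the peak gives `c` the form `suc k`, so the values below it are those from 1 to
  -- `k`.
  with 1≤as , s≤s {n = k} z≤n ∷ 1≤bs ← All.++⁻ as pos
  with as↗′ , as≤c ← AllPairs-∷ʳ⁻ (Linked⇒AllPairs ≤-trans as↗)
  with blocks-complete k as↗′ 1≤as as≤c (λ 1≤i i<c → proj₁ (full i<c 1≤i))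
     | blocks-complete k (AllPairs-reverse⁺ (Linked⇒AllPairs (flip ≤-trans) bs↘))
         (All-reverse⁺ 1≤bs) (All-reverse⁺ (All.map <⇒≤ bs<c))
         (λ 1≤i i<c → Any.reverse⁺ (proj₂ (full i<c 1≤i)))
... | r , es , refl | zero , ds , eq = (k , r , es , ds) ,
  cong (λ ys → blocks 1 r es ++ suc k ∷ ys) (trans (sym (reverse-involutive bs)) (cong reverse eq))
-- A positive count would put a copy of the peak value to the right of the peak.
... | _ | suc r′ , ds , eq = contradiction
  (All.lookup (All-reverse⁺ bs<c) (subst (suc k ∈_) (sym eq) (top∈blocks 1 r′ ds))) (<-irrefl refl)

toSymbol-injective : ∀ {z w} → toSymbol z ≡ toSymbol w → z ≡ w
toSymbol-injective {k , r , es , ds} {k′ , r′ , es′ , ds′} eq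
  with refl ← suc-injective (trans (sym (length-row 0 ds))
                (trans (cong (length ∘ proj₁) eq) (length-row 0 ds′)))
  with refl , refl ← row-injective {r = 0} {0} ds ds′ (cong proj₁ eq)
     | refl , refl ← row-injective {r = r} {r′} es es′ (cong proj₂ eq) = refl

toSymbol-frobenius : ∀ z → IsFrobenius (toSymbol z)
toSymbol-frobenius (k , r , es , ds) = frobenius
  (trans (length-row 0 ds) (sym (length-row r es))) (row-decreasing 0 ds) (row-decreasing r es)

-- A zero in the top row excludes the empty symbol, so there are `suc k` columns for some `k`, and
-- it forces the top row to end in 0.
toSymbol-complete : ∀ {s} → IsFrobenius s → ZeroInTopRow s → ∃[ z ] s ≡ toSymbol z
toSymbol-complete {_ ∷ α , β} (frobenius len α↘ β↘) 0∈α
  with s , ds , eq ← row-complete (length α) α↘ refl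
     | r , es , refl ← row-complete (length α) β↘ (sym len)
  with refl ← 0∈row⇒≡0 s ds (subst (0 ∈_) eq 0∈α) = (length α , r , es , ds) , cong (_, row r es) eq

-- The admissible data are cut out by the size of the symbol for both families, so the equality of
-- sizes enters here, through `sum-toStack`.
stacks-parametrised : ∀ n → Parametrises toStack (λ xs → IsRecedingStack xs × sum xs ≡ n)
                                         (λ z → size (toSymbol z) ≡ n)
stacks-parametrised n = record
  { injective  = toStack-injective
  ; sound      = λ {z} eq → toStack-receding z , trans (sum-toStack z) eq
  ; complete   = toStack-complete ∘ proj₁
  ; reflecting = λ {z} (_ , eq) → trans (sym (sum-toStack z)) eq
  }

symbols-parametrised : ∀ n → Parametrises toSymbol
                               (λ s → IsFrobenius s × size s ≡ n × ZeroInTopRow s)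
                               (λ z → size (toSymbol z) ≡ n)
symbols-parametrised n = record
  { injective  = toSymbol-injective
  ; sound      = λ {z} eq → toSymbol-frobenius z , eq , 0∈row (proj₂ (proj₂ (proj₂ z)))
  ; complete   = λ (frob , _ , 0∈) → toSymbol-complete frob 0∈
  ; reflecting = λ (_ , eq , _) → eq
  }

mainTheorem5 : ∀ (n : ℕ) → g n ≡ F₀ n
-- All data have size at least 1, so size 0 lies outside the parametrisation; both counts are 1
-- there by convention.
mainTheorem5 zero      = refl
mainTheorem5 n@(suc _) = parametrised⇒equinumerous
  (stacks-parametrised n) (symbols-parametrised n)
  (recedingStacks-enumerates n) (frobeniusSymbols₀-enumerates n)
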